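{- A feasible matching algorithm can track either reference ($X$ or $Y$) with a nonnegative tracking potential $\Psi$. Serving the server paired with the reference server satisfies property (S), and composing the bijection with a minimum matching between the two reference residual sets $F_t^X$ and $F_t^Y$ satisfies property (T). Here the two properties, which are required to hold pathwise, are: (S) while tracking one reference on a request, the actual cost plus the change in $\Psi$ is at most that reference's cost on the request; (T) changing the tracked reference after prefix $t$, without changing the online state, increases $\Psi$ by at most $D_t$, where $D_t\le X_t+Y_t$.
   Context: Online metric matching: a metric space with metric $d$ contains a finite collection of labelled server copies at known points (labels stay distinct even if locations coincide, so all sets of servers are labelled multisets). Requests arrive one by one, and each must be matched immediately and irrevocably to a currently free server, at cost equal to the distance between the request and that server. The references $X,Y$ are two deterministic online matching algorithms on the same instance, simulated in parallel, so that their actions and costs on the current request are known before the tracking algorithm acts. The tracking algorithm and both references start in the same state, with the full server collection free. $X_t,Y_t$ are the cumulative costs of the references on the first $t$ requests, $F_t^X,F_t^Y$ are their residual free-server multisets after $t$ requests, and $D_t$ is the minimum cost (with respect to $d$) of a perfect matching between $F_t^X$ and $F_t^Y$. At each time the tracking algorithm has a mode, namely the reference ($X$ or $Y$) that it currently tracks. It tracks this reference through a bijection between its own residual free-server multiset and that of the tracked reference; "the server paired with the reference server" is the free server of the algorithm that this bijection pairs with the server used by the tracked reference on the current request. A tracking potential is a quantity $\Psi$, with initial value $0$, maintained along with the mode. -}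

module Defs where

open import Algebra.Bundles using (AbelianGroup)
import Algebra.Properties.CommutativeMonoid.Sum as Sum
open import Algebra.Structures using (IsAbelianGroup)
open import Data.Fin.Base using (Fin)
open import Data.Fin.Subset using (Subset; _∈_; ⊤) renaming (_-_ to _∖_)
open import Data.Fin.Subset.Properties using (_∈?_)
open import Data.Nat.Base using (ℕ; zero; suc; _<_)
open import Data.Product.Base using (∃; ∃-syntax; _×_; _,_; proj₁)
open import Function.Bundles using (_↔_; Inverse)
open import Function.Construct.Symmetry using (↔-sym)
open import Function.Metric.Structures using (IsGeneralMetric)
open import Level using (Level; _⊔_) renaming (suc to lsuc)
open import Relation.Binary.Core using (Rel)
open import Relation.Binary.PropositionalEquality.Core using (_≡_)
open import Relation.Binary.Structures using (IsTotalOrder)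
open import Relation.Nullary.Decidable.Core using (Dec; yes; no)

-- The values of distances, costs and potentials.  The additive ordered group
-- of the real numbers is the intended instance; the library has no reals, so
-- only the structure of (ℝ, +, ≤) that the notions below refer to is assumed.
record OrderedAbelianGroup c ℓ₁ ℓ₂ : Set (lsuc (c ⊔ ℓ₁ ⊔ ℓ₂)) where
  infix  4 _≈_ _≤_
  infixl 6 _+_
  infix  8 -_
  field
    Carrier        : Set c
    _≈_            : Rel Carrier ℓ₁
    _≤_            : Rel Carrier ℓ₂
    _+_            : Carrier → Carrier → Carrier
    0#             : Carrier
    -_             : Carrier → Carrier
    isAbelianGroup : IsAbelianGroup _≈_ _+_ 0# -_
    isTotalOrder   : IsTotalOrder _≈_ _≤_
    +-monoˡ-≤      : ∀ z {x y} → x ≤ y → x + z ≤ y + z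

  abelianGroup : AbelianGroup c ℓ₁
  abelianGroup = record { isAbelianGroup = isAbelianGroup }

  infixl 6 _-_
  _-_ : Carrier → Carrier → Carrier
  x - y = x + (- y)

  open Sum (AbelianGroup.commutativeMonoid abelianGroup) public using (sum)

-- Server copies are the labels in Fin n; location need not be injective.
record Instance {c ℓ₁ ℓ₂} (V : OrderedAbelianGroup c ℓ₁ ℓ₂) a ℓ
                : Set (c ⊔ ℓ₁ ⊔ ℓ₂ ⊔ lsuc (a ⊔ ℓ)) where
  open OrderedAbelianGroup V
  infix 4 _≈ₚ_
  field
    Point    : Set a
    _≈ₚ_     : Rel Point ℓ
    d        : Point → Point → Carrier
    isMetric : IsGeneralMetric _≈ₚ_ _≈_ _≤_ 0# _+_ d
    n        : ℕ
    location : Fin n → Point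

module Matching {c ℓ₁ ℓ₂ a ℓ} {V : OrderedAbelianGroup c ℓ₁ ℓ₂}
                (I : Instance V a ℓ) where
  open OrderedAbelianGroup V
  open Instance I

  PerfectMatching : Subset n → Subset n → Set
  PerfectMatching F G = ∃ (_∈ F) ↔ ∃ (_∈ G)

  edgeCost : ∀ {F G} → PerfectMatching F G → ∀ s → Dec (s ∈ F) → Carrier
  edgeCost m s (yes s∈F) = d (location s) (location (proj₁ (Inverse.to m (s , s∈F))))
  edgeCost m s (no  _)   = 0#

  matchingCost : ∀ {F G} → PerfectMatching F G → Carrier
  matchingCost {F} m = sum λ s → edgeCost m s (s ∈? F)

  IsMinimum : ∀ {F G} → PerfectMatching F G → Set ℓ₂
  IsMinimum {F} {G} m = ∀ (m′ : PerfectMatching F G) → matchingCost m ≤ matchingCost m′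

  IsMinimumCost : Subset n → Subset n → Carrier → Set (ℓ₁ ⊔ ℓ₂)
  IsMinimumCost F G δ =
    ∃[ m ] IsMinimum {F} {G} m × matchingCost m ≈ δ

  -- The first t requests, latest last.  There are at most n of them, since
  -- every request consumes a server.
  infixl 5 _▷_
  data Prefix : ℕ → Set a where
    ε   : Prefix zero
    _▷_ : ∀ {t} → Prefix t → Point → .{t<n : t < n} → Prefix (suc t)

  -- A deterministic rule: which server gets the last request of a prefix.
  Rule : Set a
  Rule = ∀ {t} → Prefix (suc t) → Fin n

  residual : Rule → ∀ {t} → Prefix t → Subset n
  residual A ε                  = ⊤
  residual A ((rs ▷ r) {t<n}) = residual A rs ∖ A ((rs ▷ r) {t<n})

  record OnlineAlgorithm : Set a where
    field
      assign   : Rule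
      feasible : ∀ {t} (rs : Prefix t) r .{t<n : t < n} →
                 assign ((rs ▷ r) {t<n}) ∈ residual assign rs

    free : ∀ {t} → Prefix t → Subset n
    free = residual assign

    cost : ∀ {t} → Prefix t → Point → .(t < n) → Carrier
    cost rs r t<n = d r (location (assign ((rs ▷ r) {t<n})))

    cumulativeCost : ∀ {t} → Prefix t → Carrier
    cumulativeCost ε                = 0#
    cumulativeCost ((rs ▷ r) {t<n}) = cumulativeCost rs + cost rs r t<n

open Matching public using (OnlineAlgorithm)

module Tracking {c ℓ₁ ℓ₂ a ℓ} {V : OrderedAbelianGroup c ℓ₁ ℓ₂}
                {I : Instance V a ℓ} (X Y : OnlineAlgorithm I) where
  open OrderedAbelianGroup V
  open Instance I
  open Matching I hiding (OnlineAlgorithm)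
  open OnlineAlgorithm using (assign; feasible; cost; cumulativeCost)
    renaming (free to freeOf)

  data Mode : Set where
    trackX trackY : Mode

  other : Mode → Mode
  other trackX = trackY
  other trackY = trackX

  reference : Mode → OnlineAlgorithm I
  reference trackX = X
  reference trackY = Y

  -- A pathwise history ending after the given requests in the given mode.
  -- Mode changes are made by an arbitrary outside controller, at any time and
  -- any number of times, with any minimum matching between the reference
  -- residual sets.
  data Run : ∀ {t} → Prefix t → Mode → Set (a ⊔ ℓ₂) where
    start  : ∀ ρ → Run ε ρ
    serve  : ∀ {t} {rs : Prefix t} {ρ} → Run rs ρ →
             (r : Point) .(t<n : t < n) → Run ((rs ▷ r) {t<n}) ρ
    switch : ∀ {t} {rs : Prefix t} {ρ} → Run rs ρ →
             (m : PerfectMatching (freeOf X rs) (freeOf Y rs)) → IsMinimum m →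
             Run rs (other ρ)

  -- The server given to the next request.
  Tracker : Set (a ⊔ ℓ₂)
  Tracker = ∀ {t} {rs : Prefix t} {ρ} → Run rs ρ → Point → .(t < n) → Fin n

  free : Tracker → ∀ {t} {rs : Prefix t} {ρ} → Run rs ρ → Subset n
  free A (start ρ)      = ⊤
  free A (serve R r p)  = free A R ∖ A R r p
  free A (switch R _ _) = free A R

  Feasible : Tracker → Set (a ⊔ ℓ₂)
  Feasible A = ∀ {t} {rs : Prefix t} {ρ} (R : Run rs ρ) r .(t<n : t < n) →
               A R r t<n ∈ free A R

  Pairing : Tracker → Set (a ⊔ ℓ₂)
  Pairing A = ∀ {t} {rs : Prefix t} {ρ} (R : Run rs ρ) →
              PerfectMatching (free A R) (freeOf (reference ρ) rs)

  oriented : ∀ {t} (rs : Prefix t) ρ → PerfectMatching (freeOf X rs) (freeOf Y rs) →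
             PerfectMatching (freeOf (reference ρ) rs) (freeOf (reference (other ρ)) rs)
  oriented rs trackX m = m
  oriented rs trackY m = ↔-sym m

  record TracksThrough (A : Tracker) (σ : Pairing A) : Set (a ⊔ ℓ₂) where
    open Inverse
    field
      initially-identity : ∀ ρ s → to (σ (start ρ)) s ≡ s

      serves-paired : ∀ {t} {rs : Prefix t} {ρ} (R : Run rs ρ) r .(t<n : t < n) →
        A R r t<n ≡ proj₁ (from (σ R) ( assign (reference ρ) ((rs ▷ r) {t<n})
                                      , feasible (reference ρ) rs r {t<n}))

      keeps-other-pairs : ∀ {t} {rs : Prefix t} {ρ} (R : Run rs ρ) r .(t<n : t < n) →
        ∀ s (s∈ : s ∈ free A R) (s∈′ : s ∈ free A (serve R r t<n)) →
        proj₁ (to (σ (serve R r t<n)) (s , s∈′)) ≡ proj₁ (to (σ R) (s , s∈))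

      switch-composes : ∀ {t} {rs : Prefix t} {ρ} (R : Run rs ρ) m (min : IsMinimum m) →
        ∀ s → to (σ (switch R m min)) s ≡ to (oriented rs ρ m) (to (σ R) s)

  Potential : Set (a ⊔ c ⊔ ℓ₂)
  Potential = ∀ {t} {rs : Prefix t} {ρ} → Run rs ρ → Carrier

  NonNegative : Potential → Set (a ⊔ ℓ₂)
  NonNegative Ψ = ∀ {t} {rs : Prefix t} {ρ} (R : Run rs ρ) → 0# ≤ Ψ R

  InitiallyZero : Potential → Set ℓ₁
  InitiallyZero Ψ = ∀ ρ → Ψ (start ρ) ≈ 0#

  PropertyS : Tracker → Potential → Set (a ⊔ ℓ₂)
  PropertyS A Ψ = ∀ {t} {rs : Prefix t} {ρ} (R : Run rs ρ) r .(t<n : t < n) →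
    d r (location (A R r t<n)) + (Ψ (serve R r t<n) - Ψ R) ≤ cost (reference ρ) rs r t<n

  -- δ is D_t: it is determined up to ≈, and its existence is part of the claim.
  PropertyT : Potential → Set (a ⊔ c ⊔ ℓ₁ ⊔ ℓ₂)
  PropertyT Ψ = ∀ {t} (rs : Prefix t) →
    ∃[ δ ] IsMinimumCost (freeOf X rs) (freeOf Y rs) δ
         × δ ≤ cumulativeCost X rs + cumulativeCost Y rs
         × (∀ {ρ} (R : Run rs ρ) m (min : IsMinimum m) → Ψ (switch R m min) - Ψ R ≤ δ)

{-# OPTIONS --safe #-}
module Submission where

-- Let Ψ be the cost of the pairing between the algorithm's free servers and those of
-- the tracked reference.  Serving r removes a pair (x , y) from it, which lowers Ψ by
-- d x y, while d r x ≤ d r y + d y x; this is (S).  Composing with a minimum matching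
-- of the reference residuals raises Ψ by at most D_t, by the triangle inequality edge
-- by edge; this is (T).  For D_t ≤ X_t + Y_t, a matching of the residuals is maintained
-- by induction on t: when X uses x and Y uses y, the partner of y is rematched with the
-- partner of x, which costs at most d x y ≤ d x r + d r y more.

open import Defs
open import Algebra.Bundles using (AbelianGroup)
import Algebra.Properties.CommutativeMonoid.Sum as Sum
import Algebra.Solver.CommutativeMonoid as CommutativeMonoidSolver
open import Data.Fin.Base using (Fin; zero; suc; finToFun; funToFin; punchIn)
open import Data.Fin.Properties using (_≟_; all?; punchInᵢ≢i; finToFun-funToFin)
open import Data.Fin.Subset using (Subset; _∈_; _∉_; ⊤; ⁅_⁆) renaming (_-_ to _∖_)
open import Data.Fin.Subset.Properties using (_∈?_; p─q⊆p; x∈p∧x≢y⇒x∈p-y)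
open import Data.List.Base using (List; allFin; cartesianProductWith)
import Data.List.Extrema as Extrema
open import Data.List.Membership.Propositional.Properties
  using (∈-allFin; ∈-cartesianProductWith⁺)
import Data.List.Relation.Unary.All as All
open import Data.Nat.Base using (zero; suc; _<_; _^_)
open import Data.Product.Base using (Σ-syntax; ∃; _×_; _,_; proj₁; proj₂)
open import Data.Vec.Base using (_∷_; there)
open import Data.Vec.Functional using (removeAt)
open import Data.Vec.Properties.WithK using ([]=-irrelevant)
open import Function.Base using (_∘_)
open import Function.Bundles using (Inverse; mk↔ₛ′)
open import Function.Construct.Composition using (_↔-∘_)
open import Function.Construct.Identity using (↔-id)
open import Function.Construct.Symmetry using (↔-sym)
open import Function.Metric.Structures using (IsGeneralMetric)
open import Relation.Binary.Bundles using (TotalOrder)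
open import Relation.Binary.PropositionalEquality.Core
  using (_≡_; _≢_; refl; sym; trans; cong; subst)
import Relation.Binary.Reasoning.PartialOrder as PosetReasoning
open import Relation.Binary.Structures using (IsTotalOrder)
open import Relation.Nullary.Decidable.Core using (Dec; yes; no; map′; _×-dec_; _→-dec_)
open import Relation.Nullary.Negation.Core using (contradiction)

open Inverse using (to; from; strictlyInverseˡ; strictlyInverseʳ)

-- Subsets with one element removed, and members as labelled elements.

x∉p∖x : ∀ {n} {p : Subset n} {x} → x ∉ p ∖ x
x∉p∖x {p = _ ∷ p} {zero}  ()
x∉p∖x {p = _ ∷ p} {suc x} (there x∈) = x∉p∖x {p = p} x∈

s∈p∖x⇒s≢x : ∀ {n} {p : Subset n} {s x} → s ∈ p ∖ x → s ≢ x
s∈p∖x⇒s≢x {p = p} s∈ refl = x∉p∖x {p = p} s∈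

p∖x⊆p : ∀ {n} {p : Subset n} {s} x → s ∈ p ∖ x → s ∈ p
p∖x⊆p {p = p} x = p─q⊆p p ⁅ x ⁆

-- Membership proofs are unique, so a member is determined by its label. This identifies the
-- arguments of a bijection when the same label arrives with different proofs.
member-≡ : ∀ {n} {F : Subset n} {s t : ∃ (_∈ F)} → proj₁ s ≡ proj₁ t → s ≡ t
member-≡ {s = s , p} {t = _ , q} refl = cong (s ,_) ([]=-irrelevant p q)

-- Inequalities and finite sums in an ordered abelian group.

module OrderedGroupProperties {c ℓ₁ ℓ₂} (V : OrderedAbelianGroup c ℓ₁ ℓ₂) where
  open OrderedAbelianGroup V
  open AbelianGroup abelianGroup public
    using (commutativeMonoid)
    renaming ( refl to ≈-refl; sym to ≈-sym; trans to ≈-trans; reflexive to ≈-reflexive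
             ; ∙-cong to +-cong; ∙-congˡ to +-congˡ; ∙-congʳ to +-congʳ
             ; comm to +-comm; assoc to +-assoc
             ; identityˡ to +-identityˡ; identityʳ to +-identityʳ
             ; inverseʳ to -‿inverseʳ)
  open IsTotalOrder isTotalOrder public
    using () renaming (refl to ≤-refl; reflexive to ≤-reflexive; trans to ≤-trans)
  open Sum commutativeMonoid public
    using (sum-remove; sum-replicate-zero; sum-cong-≋; ∑-distrib-+; ∑-comm)

  totalOrder : TotalOrder c ℓ₁ ℓ₂
  totalOrder = record { isTotalOrder = isTotalOrder }

  module ≤-Reasoning = PosetReasoning (TotalOrder.poset totalOrder)

  +-mono-≤ : ∀ {w x y z} → w ≤ x → y ≤ z → w + y ≤ x + z
  +-mono-≤ {w} {x} {y} {z} w≤x y≤z = begin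
    w + y  ≤⟨ +-monoˡ-≤ y w≤x ⟩
    x + y  ≈⟨ +-comm x y ⟩
    y + x  ≤⟨ +-monoˡ-≤ x y≤z ⟩
    z + x  ≈⟨ +-comm z x ⟩
    x + z  ∎
    where open ≤-Reasoning

  +-monoʳ-≤ : ∀ x {y z} → y ≤ z → x + y ≤ x + z
  +-monoʳ-≤ x = +-mono-≤ (≤-refl {x})

  x≤y+z⇒x-z≤y : ∀ {x y z} → x ≤ y + z → x - z ≤ y
  x≤y+z⇒x-z≤y {x} {y} {z} x≤y+z = begin
    x - z        ≤⟨ +-monoˡ-≤ (- z) x≤y+z ⟩
    y + z - z    ≈⟨ +-assoc y z (- z) ⟩
    y + (z - z)  ≈⟨ +-congˡ (-‿inverseʳ z) ⟩
    y + 0#       ≈⟨ +-identityʳ y ⟩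
    y            ∎
    where open ≤-Reasoning

  sum-mono : ∀ {n} {f g : Fin n → Carrier} → (∀ i → f i ≤ g i) → sum f ≤ sum g
  sum-mono {zero}  f≤g = ≤-refl
  sum-mono {suc n}  f≤g = +-mono-≤ (f≤g zero) (sum-mono (f≤g ∘ suc))

  sum-zero : ∀ {n} {f : Fin n → Carrier} → (∀ i → f i ≈ 0#) → sum f ≈ 0#
  sum-zero {n} f≈0 = ≈-trans (sum-cong-≋ f≈0) (sum-replicate-zero n)

  sum-nonNegative : ∀ {n} {f : Fin n → Carrier} → (∀ i → 0# ≤ f i) → 0# ≤ sum f
  sum-nonNegative {n} 0≤f =
    ≤-trans (≤-reflexive (≈-sym (sum-replicate-zero n))) (sum-mono 0≤f)

  -- Splitting off index `i` leaves the same remainder in both sums. The main use has `f` and `g` as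
  -- the edge costs before and after the pair at `i` is removed.
  sum-except : ∀ {n} {f g : Fin n → Carrier} i → (∀ j → j ≢ i → f j ≈ g j) → g i ≈ 0# →
               sum f ≈ f i + sum g
  sum-except {suc n} {f} {g} i f≈g gᵢ≈0 = begin-equality
    sum f                            ≈⟨ sum-remove f ⟩
    f i + sum (removeAt f i)         ≈⟨ +-congˡ (sum-cong-≋ λ j → f≈g (punchIn i j) (punchInᵢ≢i i j)) ⟩
    f i + sum (removeAt g i)         ≈⟨ +-congˡ (+-identityˡ _) ⟨
    f i + (0# + sum (removeAt g i))  ≈⟨ +-congˡ (+-congʳ gᵢ≈0) ⟨
    f i + (g i + sum (removeAt g i)) ≈⟨ +-congˡ (sum-remove g) ⟨
    f i + sum g                      ∎
    where open ≤-Reasoning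

  sum-single : ∀ {n} {f : Fin n → Carrier} i → (∀ j → j ≢ i → f j ≈ 0#) → sum f ≈ f i
  -- Here `g` is the zero function.
  sum-single {n} i f≈0 = ≈-trans (sum-except i f≈0 ≈-refl)
    (≈-trans (+-congˡ (sum-replicate-zero n)) (+-identityʳ _))

-- Edge costs and matching costs.

module MatchingProperties {c ℓ₁ ℓ₂ a ℓ} {V : OrderedAbelianGroup c ℓ₁ ℓ₂}
                          (I : Instance V a ℓ) where
  open OrderedAbelianGroup V
  open OrderedGroupProperties V
  open Instance I
  open Matching I hiding (OnlineAlgorithm)
  private module d = IsGeneralMetric isMetric

  ∣_,_∣ : Fin n → Fin n → Carrier
  ∣ s , u ∣ = d (location s) (location u)

  d-self : ∀ s → ∣ s , s ∣ ≈ 0#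
  d-self s = d.≈⇒0 d.EqC.refl

  edgeLength : ∀ {F G} → PerfectMatching F G → ∃ (_∈ F) → Carrier
  edgeLength m p = ∣ proj₁ p , proj₁ (to m p) ∣

  edgeCost-yes : ∀ {F G} (m : PerfectMatching F G) s (s∈F : s ∈ F) (s∈? : Dec (s ∈ F)) →
                 edgeCost m s s∈? ≡ edgeLength m (s , s∈F)
  edgeCost-yes m s s∈F (yes s∈F′) = cong (edgeLength m) (member-≡ refl)
  edgeCost-yes m s s∈F (no s∉F)   = contradiction s∈F s∉F

  -- The matchings may have different source sets. The two implications at `s` make both membership
  -- decisions agree, so the costs can be compared label by label.
  edgeCost-cong : ∀ {F G F′ G′} (m : PerfectMatching F G) (m′ : PerfectMatching F′ G′) {s} →
    (s ∈ F → s ∈ F′) → (s ∈ F′ → s ∈ F) →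
    (∀ p p′ → proj₁ (to m (s , p)) ≡ proj₁ (to m′ (s , p′))) →
    edgeCost m s (s ∈? F) ≡ edgeCost m′ s (s ∈? F′)
  edgeCost-cong {F} {F′ = F′} m m′ {s} f g eq with s ∈? F | s ∈? F′
  ... | yes p | yes p′ = cong ∣ s ,_∣ (eq p p′)
  ... | yes p | no ¬p′ = contradiction (f p) ¬p′
  ... | no ¬p | yes p′ = contradiction (g p′) ¬p
  ... | no _  | no _   = refl

  matchingCost-cong : ∀ {F G} (m m′ : PerfectMatching F G) →
    (∀ p → proj₁ (to m p) ≡ proj₁ (to m′ p)) → matchingCost m ≈ matchingCost m′
  matchingCost-cong m m′ eq = sum-cong-≋ λ s → ≈-reflexive
    (edgeCost-cong m m′ (λ p → p) (λ p → p)
      λ p p′ → trans (cong (proj₁ ∘ to m) (member-≡ refl)) (eq (s , p′)))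

  matchingCost-nonNegative : ∀ {F G} (m : PerfectMatching F G) → 0# ≤ matchingCost m
  matchingCost-nonNegative {F} m = sum-nonNegative λ s → nonNegative s (s ∈? F)
    where
    nonNegative : ∀ s s∈? → 0# ≤ edgeCost m s s∈?
    nonNegative s (yes _) = d.nonNegative
    nonNegative s (no _)  = ≤-refl

  matchingCost-id : ∀ {F} → matchingCost (↔-id (∃ (_∈ F))) ≈ 0#
  matchingCost-id {F} = sum-zero λ s → zeroEdge s (s ∈? F)
    where
    zeroEdge : ∀ s s∈? → edgeCost (↔-id (∃ (_∈ F))) s s∈? ≈ 0#
    zeroEdge s (yes _) = d-self s
    zeroEdge s (no _)  = ≈-refl

  -- Sums over a subset, reindexing, composition and inversion of matchings.

  extend : ∀ {F : Subset n} → (∃ (_∈ F) → Carrier) → ∀ s → Dec (s ∈ F) → Carrier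
  extend h s (yes p) = h (s , p)
  extend h s (no _)  = 0#

  -- Extension by zero lets the sum run over all labels, as `matchingCost` does, even though `h` is
  -- defined on members only.
  sumOver : ∀ F → (∃ (_∈ F) → Carrier) → Carrier
  sumOver F h = sum λ s → extend h s (s ∈? F)

  extend-yes : ∀ {F} (h : ∃ (_∈ F) → Carrier) p s∈? → extend h (proj₁ p) s∈? ≡ h p
  extend-yes h (s , p) (yes _) = cong h (member-≡ refl)
  extend-yes h (s , p) (no ¬p) = contradiction p ¬p

  -- Both sides are the sum over s and u of h u restricted to the pairs matched by m.
  sumOver-reindex : ∀ {F G} (m : PerfectMatching F G) h →
                    sumOver F (h ∘ to m) ≈ sumOver G h
  sumOver-reindex {F} {G} m h = begin-equality
    sum (λ s → extend (h ∘ to m) s (s ∈? F))  ≈⟨ sum-cong-≋ (λ s → row s (s ∈? F)) ⟩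
    sum (λ s → sum λ u → entry s (s ∈? F) u)  ≈⟨ ∑-comm (λ s u → entry s (s ∈? F) u) ⟩
    sum (λ u → sum λ s → entry s (s ∈? F) u)  ≈⟨ sum-cong-≋ (λ u → column u (u ∈? G)) ⟩
    sum (λ u → extend h u (u ∈? G))           ∎
    where
    open ≤-Reasoning

    weight : (p : ∃ (_∈ F)) → ∀ u → Dec (proj₁ (to m p) ≡ u) → Carrier
    weight p u (yes _) = h (to m p)
    weight p u (no _)  = 0#

    entry : ∀ s → Dec (s ∈ F) → Fin n → Carrier
    entry s s∈? u = extend (λ p → weight p u (proj₁ (to m p) ≟ u)) s s∈?

    weight-yes : ∀ p {u} dec → proj₁ (to m p) ≡ u → weight p u dec ≡ h (to m p)
    weight-yes p (yes _)   eq = refl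
    weight-yes p (no ¬eq) eq = contradiction eq ¬eq

    weight-no : ∀ p {u} dec → proj₁ (to m p) ≢ u → weight p u dec ≡ 0#
    weight-no p (yes eq) ¬eq = contradiction eq ¬eq
    weight-no p (no _)   ¬eq = refl

    row : ∀ s s∈? → extend (h ∘ to m) s s∈? ≈ sum (entry s s∈?)
    row s (yes s∈F) = ≈-sym (≈-trans
      (sum-single u λ v v≢u → ≈-reflexive (weight-no p (u ≟ v) (v≢u ∘ sym)))
      (≈-reflexive (weight-yes p (u ≟ u) refl)))
      where
      p = s , s∈F
      u = proj₁ (to m p)
    row s (no _) = ≈-sym (sum-zero {n} λ _ → ≈-refl)

    column : ∀ u u∈? → sum (λ s → entry s (s ∈? F) u) ≈ extend h u u∈?
    column u (yes u∈G) = ≈-trans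
      -- Injectivity of `m` leaves only the partner `q` of `u` in this column.
      (sum-single (proj₁ q) λ s s≢ → off s (s ∈? F) s≢)
      (≈-reflexive (trans (extend-yes _ q (proj₁ q ∈? F))
        (trans (weight-yes q (proj₁ (to m q) ≟ u) (cong proj₁ mq≡u)) (cong h mq≡u))))
      where
      q = from m (u , u∈G)
      mq≡u : to m q ≡ (u , u∈G)
      mq≡u = strictlyInverseˡ m (u , u∈G)
      off : ∀ s s∈? → s ≢ proj₁ q → entry s s∈? u ≈ 0#
      off s (yes s∈F) s≢ = ≈-reflexive (weight-no (s , s∈F) (_ ≟ u) λ eq →
        s≢ (cong proj₁ (trans (sym (strictlyInverseʳ m (s , s∈F))) (cong (from m) (member-≡ eq)))))
      off s (no _)    s≢ = ≈-refl
    column u (no u∉G) = sum-zero λ s → off s (s ∈? F)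
      where
      off : ∀ s s∈? → entry s s∈? u ≈ 0#
      off s (yes s∈F) = ≈-reflexive (weight-no (s , s∈F) (_ ≟ u) λ eq →
        u∉G (subst (_∈ G) eq (proj₂ (to m (s , s∈F)))))
      off s (no _)    = ≈-refl

  matchingCost≈sumOver : ∀ {F G} (m : PerfectMatching F G) →
                         matchingCost m ≈ sumOver F (edgeLength m)
  matchingCost≈sumOver {F} m = sum-cong-≋ λ s → edge s (s ∈? F)
    where
    edge : ∀ s s∈? → edgeCost m s s∈? ≈ extend (edgeLength m) s s∈?
    edge s (yes _) = ≈-refl
    edge s (no _)  = ≈-refl

  -- The triangle inequality on each edge bounds it by an edge of `m` followed by an edge of `m′`.
  -- The latter are indexed by `F` through `m`, and reindexing over `G` gives the cost of `m′`.
  matchingCost-∘ : ∀ {F G H} (m′ : PerfectMatching G H) (m : PerfectMatching F G) →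
                   matchingCost (m′ ↔-∘ m) ≤ matchingCost m′ + matchingCost m
  matchingCost-∘ {F} {G} m′ m = begin
    matchingCost (m′ ↔-∘ m)
      ≤⟨ sum-mono (λ s → edge s (s ∈? F)) ⟩
    sum (λ s → edgeCost m s (s ∈? F) + extend (edgeLength m′ ∘ to m) s (s ∈? F))
      ≈⟨ ∑-distrib-+ (λ s → edgeCost m s (s ∈? F)) _ ⟩
    matchingCost m + sumOver F (edgeLength m′ ∘ to m)
      ≈⟨ +-congˡ (≈-trans (sumOver-reindex m (edgeLength m′)) (≈-sym (matchingCost≈sumOver m′))) ⟩
    matchingCost m + matchingCost m′
      ≈⟨ +-comm _ _ ⟩
    matchingCost m′ + matchingCost m ∎
    where
    open ≤-Reasoning
    edge : ∀ s s∈? → edgeCost (m′ ↔-∘ m) s s∈? ≤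
                     edgeCost m s s∈? + extend (edgeLength m′ ∘ to m) s s∈?
    edge s (yes _) = d.triangle _ _ _
    edge s (no _)  = ≤-reflexive (≈-sym (+-identityˡ 0#))

  -- Reindexed along `m`, each reversed edge ends at the member of `F` it came from; symmetry of `d`
  -- does the rest.
  matchingCost-sym : ∀ {F G} (m : PerfectMatching F G) →
                     matchingCost (↔-sym m) ≈ matchingCost m
  matchingCost-sym {F} {G} m = begin-equality
    matchingCost (↔-sym m)                   ≈⟨ matchingCost≈sumOver (↔-sym m) ⟩
    sumOver G (edgeLength (↔-sym m))         ≈⟨ sumOver-reindex m (edgeLength (↔-sym m)) ⟨
    sumOver F (edgeLength (↔-sym m) ∘ to m)  ≈⟨ sum-cong-≋ (λ s → edge s (s ∈? F)) ⟩
    matchingCost m                           ∎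
    where
    open ≤-Reasoning
    edge : ∀ s s∈? → extend (edgeLength (↔-sym m) ∘ to m) s s∈? ≈ edgeCost m s s∈?
    edge s (yes s∈F) = ≈-trans
      (≈-reflexive (cong (λ p → ∣ proj₁ (to m (s , s∈F)) , proj₁ p ∣) (strictlyInverseʳ m (s , s∈F))))
      (d.sym _ _)
    edge s (no _) = ≈-refl

  -- Constructing matchings, removing a pair, and exchanging partners.

  record MutuallyInverse (F G : Subset n) (f g : Fin n → Fin n) : Set where
    field
      to-∈   : ∀ s → s ∈ F → f s ∈ G
      from-∈ : ∀ u → u ∈ G → g u ∈ F
      inverseˡ : ∀ u → u ∈ G → f (g u) ≡ u
      inverseʳ : ∀ s → s ∈ F → g (f s) ≡ s

  -- Values of `f` outside `F` and of `g` outside `G` are arbitrary. Stating the laws over labels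
  -- makes them decidable by a search of `Fin n`.
  matching : ∀ {F G f g} → MutuallyInverse F G f g → PerfectMatching F G
  matching {f = f} {g} inv = mk↔ₛ′
    (λ (s , s∈F) → f s , to-∈ s s∈F) (λ (u , u∈G) → g u , from-∈ u u∈G)
    (λ (u , u∈G) → member-≡ (inverseˡ u u∈G)) (λ (s , s∈F) → member-≡ (inverseʳ s s∈F))
    where open MutuallyInverse inv

  -- The restricted maps avoid the removed elements because `m` is injective in both directions.
  removePair : ∀ {F G} (m : PerfectMatching F G) (q : ∃ (_∈ G)) →
               PerfectMatching (F ∖ proj₁ (from m q)) (G ∖ proj₁ q)
  removePair {F} {G} m q = mk↔ₛ′ f g
    (λ (u , u∈) → member-≡ (trans (cong (proj₁ ∘ to m) (member-≡ refl))
                                   (cong proj₁ (strictlyInverseˡ m (u , p∖x⊆p y u∈)))))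
    (λ (s , s∈) → member-≡ (trans (cong (proj₁ ∘ from m) (member-≡ refl))
                                   (cong proj₁ (strictlyInverseʳ m (s , p∖x⊆p x s∈)))))
    where
    y = proj₁ q
    x = proj₁ (from m q)

    f : ∃ (_∈ F ∖ x) → ∃ (_∈ G ∖ y)
    f (s , s∈) = proj₁ u , x∈p∧x≢y⇒x∈p-y (proj₂ u) λ u≡y → s∈p∖x⇒s≢x {p = F} s∈
      (cong proj₁ (trans (sym (strictlyInverseʳ m _)) (cong (from m) (member-≡ u≡y))))
      where u = to m (s , p∖x⊆p x s∈)

    g : ∃ (_∈ G ∖ y) → ∃ (_∈ F ∖ x)
    g (u , u∈) = proj₁ s , x∈p∧x≢y⇒x∈p-y (proj₂ s) λ s≡x → s∈p∖x⇒s≢x {p = G} u∈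
      (cong proj₁ (trans (sym (strictlyInverseˡ m _))
        (trans (cong (to m) (member-≡ s≡x)) (strictlyInverseˡ m q))))
      where s = from m (u , p∖x⊆p y u∈)

  -- Every edge except the one at `x` is unchanged, and `x` is no longer a source, so exactly its
  -- edge is lost.
  matchingCost-removePair : ∀ {F G} (m : PerfectMatching F G) q →
    matchingCost m ≈ ∣ proj₁ (from m q) , proj₁ q ∣ + matchingCost (removePair m q)
  matchingCost-removePair {F} {G} m q = ≈-trans
    (sum-except x
      (λ s s≢x → ≈-reflexive (edgeCost-cong m (removePair m q)
        (λ s∈F → x∈p∧x≢y⇒x∈p-y s∈F s≢x) (p∖x⊆p x) (λ _ _ → cong (proj₁ ∘ to m) (member-≡ refl))))
      (removed (x ∈? F ∖ x)))
    (+-congʳ (≈-reflexive (trans (edgeCost-yes m x (proj₂ (from m q)) (x ∈? F))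
      (cong (λ u → ∣ x , proj₁ u ∣) (strictlyInverseˡ m q)))))
    where
    x = proj₁ (from m q)
    removed : ∀ x∈? → edgeCost (removePair m q) x x∈? ≈ 0#
    removed (yes x∈) = contradiction x∈ (x∉p∖x {p = F})
    removed (no _)   = ≈-refl

  redirect : Fin n → Fin n → Fin n → Fin n
  redirect x x′ s with s ≟ x′
  ... | yes _ = x
  ... | no _  = s

  redirect-at : ∀ x x′ → redirect x x′ x′ ≡ x
  redirect-at x x′ with x′ ≟ x′
  ... | yes _ = refl
  ... | no ¬p = contradiction refl ¬p

  redirect-off : ∀ x x′ s → s ≢ x′ → redirect x x′ s ≡ s
  redirect-off x x′ s s≢x′ with s ≟ x′
  ... | yes s≡x′ = contradiction s≡x′ s≢x′
  ... | no _     = refl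

  redirect-∈ : ∀ {F x x′} → x ∈ F → ∀ s → s ∈ F ∖ x → redirect x x′ s ∈ F ∖ x′
  redirect-∈ {F} {x} {x′} x∈F s s∈ with s ≟ x′
  ... | yes refl = x∈p∧x≢y⇒x∈p-y x∈F (s∈p∖x⇒s≢x {p = F} s∈ ∘ sym)
  ... | no s≢x′  = x∈p∧x≢y⇒x∈p-y (p∖x⊆p x s∈) s≢x′

  redirect-inverse : ∀ {F x x′} s → s ∈ F ∖ x → redirect x′ x (redirect x x′ s) ≡ s
  redirect-inverse {F} {x} {x′} s s∈ with s ≟ x′
  ... | yes refl = redirect-at x′ x
  ... | no _     = redirect-off x′ x s (s∈p∖x⇒s≢x {p = F} s∈)

  -- The two sets differ only in that the first may contain `x′` and the second `x`, so `x′` is sent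
  -- to `x` and every other label stays put. If `x` and `x′` coincide this is the identity.
  relocate : ∀ {F x x′} → x ∈ F → x′ ∈ F → PerfectMatching (F ∖ x) (F ∖ x′)
  relocate {F} {x} {x′} x∈F x′∈F = matching {f = redirect x x′} {redirect x′ x} record
    { to-∈     = redirect-∈ x∈F
    ; from-∈   = redirect-∈ x′∈F
    ; inverseˡ = redirect-inverse {F}
    ; inverseʳ = redirect-inverse {F}
    }

  -- Only the edge at `x′` can have nonzero length. When `x` and `x′` coincide, `x′` is not a source
  -- at all, and nonnegativity of `d` gives the bound.
  matchingCost-relocate : ∀ {F x x′} (x∈F : x ∈ F) (x′∈F : x′ ∈ F) →
                          matchingCost (relocate x∈F x′∈F) ≤ ∣ x′ , x ∣
  matchingCost-relocate {F} {x} {x′} x∈F x′∈F = begin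
    matchingCost (relocate x∈F x′∈F)              ≈⟨ sum-single x′ (λ s s≢x′ → off s s≢x′ (s ∈? F ∖ x)) ⟩
    edgeCost (relocate x∈F x′∈F) x′ (x′ ∈? F ∖ x) ≤⟨ at (x′ ∈? F ∖ x) ⟩
    ∣ x′ , x ∣                                    ∎
    where
    open ≤-Reasoning
    off : ∀ s → s ≢ x′ → ∀ s∈? → edgeCost (relocate x∈F x′∈F) s s∈? ≈ 0#
    off s s≢x′ (yes _) = ≈-trans (≈-reflexive (cong ∣ s ,_∣ (redirect-off x x′ s s≢x′))) (d-self s)
    off s s≢x′ (no _)  = ≈-refl
    at : ∀ x′∈? → edgeCost (relocate x∈F x′∈F) x′ x′∈? ≤ ∣ x′ , x ∣
    at (yes _) = ≤-reflexive (≈-reflexive (cong ∣ x′ ,_∣ (redirect-at x x′)))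
    at (no _)  = d.nonNegative

  -- The partner of y is rematched with the partner of x.
  exchange : ∀ {F G x y} → PerfectMatching F G → x ∈ F → y ∈ G →
             PerfectMatching (F ∖ x) (G ∖ y)
  exchange m x∈F y∈G = removePair m q ↔-∘ relocate x∈F (proj₂ (from m q))
    where q = _ , y∈G

  matchingCost-exchange : ∀ {F G x y} (m : PerfectMatching F G) (x∈F : x ∈ F) (y∈G : y ∈ G) →
                          matchingCost (exchange m x∈F y∈G) ≤ matchingCost m + ∣ x , y ∣
  matchingCost-exchange {x = x} {y} m x∈F y∈G = begin
    matchingCost (exchange m x∈F y∈G)   ≤⟨ matchingCost-∘ (removePair m q) (relocate x∈F x′∈F) ⟩
    C + matchingCost (relocate x∈F x′∈F) ≤⟨ +-monoʳ-≤ C (matchingCost-relocate x∈F x′∈F) ⟩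
    -- The detour through `y` produces the length of the removed edge, which together with `C`
    -- restores the cost of `m`.
    C + ∣ x′ , x ∣                       ≤⟨ +-monoʳ-≤ C (d.triangle _ _ _) ⟩
    C + (∣ x′ , y ∣ + ∣ y , x ∣)         ≈⟨ +-assoc C _ _ ⟨
    C + ∣ x′ , y ∣ + ∣ y , x ∣           ≈⟨ +-cong (+-comm _ _) (d.sym _ _) ⟩
    ∣ x′ , y ∣ + C + ∣ x , y ∣           ≈⟨ +-congʳ (matchingCost-removePair m q) ⟨
    matchingCost m + ∣ x , y ∣           ∎
    where
    open ≤-Reasoning
    q    = y , y∈G
    x′   = proj₁ (from m q)
    x′∈F = proj₂ (from m q)
    C    = matchingCost (removePair m q)

  -- Existence of a minimum matching by finite enumeration.

  mutuallyInverse? : ∀ F G f g → Dec (MutuallyInverse F G f g)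
  mutuallyInverse? F G f g = map′
    (λ (p , q , r , s) → record { to-∈ = p ; from-∈ = q ; inverseˡ = r ; inverseʳ = s })
    (λ inv → let open MutuallyInverse inv in to-∈ , from-∈ , inverseˡ , inverseʳ)
    (all? (λ s → (s ∈? F) →-dec (f s ∈? G)) ×-dec
     all? (λ u → (u ∈? G) →-dec (g u ∈? F)) ×-dec
     all? (λ u → (u ∈? G) →-dec (f (g u) ≟ u)) ×-dec
     all? (λ s → (s ∈? F) →-dec (g (f s) ≟ s)))

  -- The identity outside `F` is a dummy value: it yields a function on all labels, which can be
  -- coded as an element of `Fin (n ^ n)`.
  totalise : ∀ {F G} → (∃ (_∈ F) → ∃ (_∈ G)) → Fin n → Fin n
  totalise {F} f s with s ∈? F
  ... | yes s∈F = proj₁ (f (s , s∈F))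
  ... | no _    = s

  totalise-≡ : ∀ {F G} (f : ∃ (_∈ F) → ∃ (_∈ G)) p → totalise f (proj₁ p) ≡ proj₁ (f p)
  totalise-≡ {F} f (s , s∈F) with s ∈? F
  ... | yes _   = cong (proj₁ ∘ f) (member-≡ refl)
  ... | no s∉F = contradiction s∈F s∉F

  code : ∀ {F G} → (∃ (_∈ F) → ∃ (_∈ G)) → Fin (n ^ n)
  code f = funToFin (totalise f)

  finToFun-code : ∀ {F G} (f : ∃ (_∈ F) → ∃ (_∈ G)) p →
                  finToFun (code f) (proj₁ p) ≡ proj₁ (f p)
  finToFun-code f p = trans (finToFun-funToFin (totalise f) (proj₁ p)) (totalise-≡ f p)

  code-mutuallyInverse : ∀ {F G} (m : PerfectMatching F G) →
    MutuallyInverse F G (finToFun (code (to m))) (finToFun (code (from m)))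
  code-mutuallyInverse {F} {G} m = record
    { to-∈     = λ s s∈F → subst (_∈ G) (sym (f≡ (s , s∈F))) (proj₂ (to m (s , s∈F)))
    ; from-∈   = λ u u∈G → subst (_∈ F) (sym (g≡ (u , u∈G))) (proj₂ (from m (u , u∈G)))
    ; inverseˡ = λ u u∈G → trans (cong (finToFun (code (to m))) (g≡ (u , u∈G)))
        (trans (f≡ (from m (u , u∈G))) (cong proj₁ (strictlyInverseˡ m (u , u∈G))))
    ; inverseʳ = λ s s∈F → trans (cong (finToFun (code (from m))) (f≡ (s , s∈F)))
        (trans (g≡ (to m (s , s∈F))) (cong proj₁ (strictlyInverseʳ m (s , s∈F))))
    }
    where
    f≡ = finToFun-code (to m)
    g≡ = finToFun-code (from m)

  -- Pairs of codes that do not give a matching decode to m₀.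
  module _ {F G} (m₀ : PerfectMatching F G) where
    decodeWith : ∀ {f g} → Dec (MutuallyInverse F G f g) → PerfectMatching F G
    decodeWith (yes inv) = matching inv
    decodeWith (no _)    = m₀

    decode : Fin (n ^ n) → Fin (n ^ n) → PerfectMatching F G
    decode i j = decodeWith (mutuallyInverse? F G (finToFun i) (finToFun j))

    candidates : List (PerfectMatching F G)
    candidates = cartesianProductWith decode (allFin (n ^ n)) (allFin (n ^ n))

    minimumMatching : PerfectMatching F G
    minimumMatching = Extrema.argmin totalOrder matchingCost m₀ candidates

    decode-code : ∀ m → matchingCost (decode (code (to m)) (code (from m))) ≈ matchingCost m
    decode-code m = lemma (mutuallyInverse? F G _ _)
      where
      lemma : ∀ inv? → matchingCost (decodeWith inv?) ≈ matchingCost m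
      lemma (yes inv) = matchingCost-cong (matching inv) m (finToFun-code (to m))
      lemma (no ¬inv) = contradiction (code-mutuallyInverse m) ¬inv

    -- Any `m` has the same cost as the candidate decoded from the codes of its two directions, so
    -- the minimum over the finite list bounds the cost of every matching.
    minimumMatching-isMinimum : IsMinimum minimumMatching
    minimumMatching-isMinimum m = ≤-trans
      (All.lookup (Extrema.f[argmin]≤f[xs] totalOrder {f = matchingCost} m₀ candidates)
        (∈-cartesianProductWith⁺ decode (∈-allFin (code (to m))) (∈-allFin (code (from m)))))
      (≤-reflexive (decode-code m))

module TrackingProperties {c ℓ₁ ℓ₂ a ℓ} {V : OrderedAbelianGroup c ℓ₁ ℓ₂}
                          {I : Instance V a ℓ} (X Y : OnlineAlgorithm I) where
  open OrderedAbelianGroup V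
  open OrderedGroupProperties V
  open Instance I
  open Matching I hiding (OnlineAlgorithm)
  open MatchingProperties I
  open OnlineAlgorithm using (assign; feasible; cost; cumulativeCost)
    renaming (free to freeOf)
  open Tracking X Y
  private module d = IsGeneralMetric isMetric

  -- The bound of the minimum matching cost by the cumulative reference costs.

  referenceMatching : ∀ {t} (rs : Prefix t) → PerfectMatching (freeOf X rs) (freeOf Y rs)
  referenceMatching ε                = ↔-id _
  referenceMatching ((rs ▷ r) {t<n}) =
    exchange (referenceMatching rs) (feasible X rs r {t<n}) (feasible Y rs r {t<n})

  referenceMatching-cost : ∀ {t} (rs : Prefix t) →
    matchingCost (referenceMatching rs) ≤ cumulativeCost X rs + cumulativeCost Y rs
  referenceMatching-cost ε = ≤-reflexive (≈-trans (matchingCost-id {⊤}) (≈-sym (+-identityˡ 0#)))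
  referenceMatching-cost ((rs ▷ r) {t<n}) = begin
    matchingCost (exchange (referenceMatching rs) _ _)
      ≤⟨ matchingCost-exchange (referenceMatching rs) (feasible X rs r {t<n}) (feasible Y rs r {t<n}) ⟩
    matchingCost (referenceMatching rs) + ∣ x , y ∣
      -- The path from `x` to `y` goes through the request `r`, so the increase is at most the two
      -- reference costs of this request.
      ≤⟨ +-mono-≤ (referenceMatching-cost rs) (d.triangle _ r _) ⟩
    CX + CY + (d (location x) r + cY)
      ≈⟨ +-congˡ (+-congʳ (d.sym _ _)) ⟩
    CX + CY + (cX + cY)
      ≈⟨ solve 4 (λ p q u v → (p ⊕ q) ⊕ (u ⊕ v) ⊜ (p ⊕ u) ⊕ (q ⊕ v)) ≈-refl CX CY cX cY ⟩
    CX + cX + (CY + cY) ∎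
    where
    open ≤-Reasoning
    open CommutativeMonoidSolver commutativeMonoid
    x = assign X ((rs ▷ r) {t<n})
    y = assign Y ((rs ▷ r) {t<n})
    cX = cost X rs r t<n
    cY = cost Y rs r t<n
    CX = cumulativeCost X rs
    CY = cumulativeCost Y rs

  -- The tracking algorithm, its pairing and its potential.

  requested : ∀ ρ {t} (rs : Prefix t) r .(t<n : t < n) → ∃ (_∈ freeOf (reference ρ) rs)
  requested ρ rs r t<n = assign (reference ρ) ((rs ▷ r) {t<n}) , feasible (reference ρ) rs r {t<n}

  -- A direct definition through `free tracker R` would not pass the termination check,
  -- as `free` takes the whole tracker as an argument; hence `held` and the cast below.
  mutual
    held : ∀ {t} {rs : Prefix t} {ρ} → Run rs ρ → Subset n
    held (start ρ)        = ⊤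
    held (serve R r t<n)  = held R ∖ tracker R r t<n
    held (switch R m min) = held R

    tracker : Tracker
    tracker {rs = rs} {ρ} R r t<n = proj₁ (from (pairing R) (requested ρ rs r t<n))

    pairing : ∀ {t} {rs : Prefix t} {ρ} (R : Run rs ρ) →
              PerfectMatching (held R) (freeOf (reference ρ) rs)
    pairing (start ρ)                        = ↔-id _
    pairing (serve {rs = rs} {ρ} R r t<n)    = removePair (pairing R) (requested ρ rs r t<n)
    pairing (switch {rs = rs} {ρ} R m min) = oriented rs ρ m ↔-∘ pairing R

  held≡free : ∀ {t} {rs : Prefix t} {ρ} (R : Run rs ρ) → held R ≡ free tracker R
  held≡free (start ρ)        = refl
  held≡free (serve R r t<n)  = cong (_∖ tracker R r t<n) (held≡free R)
  held≡free (switch R m min) = held≡free R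

  -- Keeping the equation between subsets general allows the lemmas below to match it with `refl`;
  -- it is then applied to `held≡free`.
  castSource : ∀ {F F′ G : Subset n} → F ≡ F′ → PerfectMatching F G → PerfectMatching F′ G
  castSource {G = G} = subst (λ F → PerfectMatching F G)

  castSource-to : ∀ {F F′ G : Subset n} (eq : F ≡ F′) (m : PerfectMatching F G) s s∈ s∈′ →
                  to (castSource eq m) (s , s∈′) ≡ to m (s , s∈)
  castSource-to refl m s s∈ s∈′ = cong (to m) (member-≡ refl)

  castSource-from : ∀ {F F′ G : Subset n} (eq : F ≡ F′) (m : PerfectMatching F G) q →
                    proj₁ (from (castSource eq m) q) ≡ proj₁ (from m q)
  castSource-from refl m q = refl

  castSource-∘ : ∀ {F F′ G H : Subset n} (eq : F ≡ F′) (m′ : PerfectMatching G H)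
                 (m : PerfectMatching F G) s →
                 to (castSource eq (m′ ↔-∘ m)) s ≡ to m′ (to (castSource eq m) s)
  castSource-∘ refl m′ m s = refl

  freePairing : Pairing tracker
  freePairing R = castSource (held≡free R) (pairing R)

  -- Measured on `pairing`, so that a request is a `removePair` and a switch is a composition by
  -- definition, with no cast in between.
  potential : Potential
  potential R = matchingCost (pairing R)

  tracker-feasible : Feasible tracker
  tracker-feasible {rs = rs} {ρ} R r t<n =
    subst (tracker R r t<n ∈_) (held≡free R) (proj₂ (from (pairing R) (requested ρ rs r t<n)))

  tracks : TracksThrough tracker freePairing
  tracks = record
    { initially-identity = λ _ _ → refl
    ; serves-paired      = λ {_} {rs} {ρ} R r t<n →
        sym (castSource-from (held≡free R) (pairing R) (requested ρ rs r t<n))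
    ; keeps-other-pairs  = keeps
    ; switch-composes    = λ {_} {rs} {ρ} R m _ → castSource-∘ (held≡free R) (oriented rs ρ m) (pairing R)
    }
    where
    keeps : ∀ {t} {rs : Prefix t} {ρ} (R : Run rs ρ) r .(t<n : t < n) →
            ∀ s (s∈ : s ∈ free tracker R) (s∈′ : s ∈ free tracker (serve R r t<n)) →
            proj₁ (to (freePairing (serve R r t<n)) (s , s∈′)) ≡ proj₁ (to (freePairing R) (s , s∈))
    -- Once both casts are undone the two sides agree by definition, since `removePair` sends a
    -- remaining label where `pairing R` does.
    keeps R r t<n s s∈ s∈′ = trans
      (cong proj₁ (castSource-to (held≡free (serve R r t<n)) (pairing (serve R r t<n)) s s∈ᵣ s∈′))
      (sym (cong proj₁ (castSource-to (held≡free R) (pairing R) s (p∖x⊆p (tracker R r t<n) s∈ᵣ) s∈)))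
      where
      s∈ᵣ : s ∈ held (serve R r t<n)
      s∈ᵣ = subst (s ∈_) (sym (held≡free (serve R r t<n))) s∈′

  -- Properties (S) and (T).

  propertyS : PropertyS tracker potential
  propertyS {rs = rs} {ρ} R r t<n = begin
    d r (location x) + (Ψ′ - Ψ)                  ≈⟨ +-assoc _ _ _ ⟨
    d r (location x) + Ψ′ - Ψ                    ≤⟨ x≤y+z⇒x-z≤y bound ⟩
    cost (reference ρ) rs r t<n                  ∎
    where
    open ≤-Reasoning
    q  = requested ρ rs r t<n
    x  = tracker R r t<n
    y  = proj₁ q
    Ψ  = potential R
    Ψ′ = potential (serve R r t<n)

    -- With `Ψ` moved to the right, the removed edge `∣ x , y ∣` combines with `Ψ′` to give exactly
    -- `Ψ`.
    bound : d r (location x) + Ψ′ ≤ d r (location y) + Ψ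
    bound = begin
      d r (location x) + Ψ′                  ≤⟨ +-monoˡ-≤ Ψ′ (d.triangle _ (location y) _) ⟩
      d r (location y) + ∣ y , x ∣ + Ψ′      ≈⟨ +-congʳ (+-congˡ (d.sym _ _)) ⟩
      d r (location y) + ∣ x , y ∣ + Ψ′      ≈⟨ +-assoc _ _ _ ⟩
      d r (location y) + (∣ x , y ∣ + Ψ′)    ≈⟨ +-congˡ (matchingCost-removePair (pairing R) q) ⟨
      d r (location y) + Ψ                   ∎

  -- Leaving `Y` traverses the matching backwards, which costs the same.
  oriented-cost : ∀ {t} (rs : Prefix t) ρ m → matchingCost (oriented rs ρ m) ≈ matchingCost m
  oriented-cost rs trackX m = ≈-refl
  oriented-cost rs trackY m = matchingCost-sym m

  propertyT : PropertyT potential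
  propertyT rs = matchingCost m₁
    , (m₁ , m₁-min , ≈-refl)
    -- The inductively maintained matching `m₀` is a competitor of the minimum `m₁`, so its bound
    -- carries over.
    , ≤-trans (m₁-min m₀) (referenceMatching-cost rs)
    , λ {ρ} R m min → x≤y+z⇒x-z≤y (≤-trans (matchingCost-∘ (oriented rs ρ m) (pairing R))
        -- The controller may switch with any minimum matching `m`; its minimality against `m₁`
        -- bounds its cost by the chosen `δ`.
        (+-monoˡ-≤ (potential R) (≤-trans (≤-reflexive (oriented-cost rs ρ m)) (min m₁))))
    where
    m₀ = referenceMatching rs
    m₁ = minimumMatching m₀
    m₁-min = minimumMatching-isMinimum m₀

lemma55 : ∀ {c ℓ₁ ℓ₂ a ℓ} {V : OrderedAbelianGroup c ℓ₁ ℓ₂} {I : Instance V a ℓ}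
    (X Y : OnlineAlgorithm I) → let open Tracking X Y in
    Σ[ A ∈ Tracker ] Σ[ σ ∈ Pairing A ] Σ[ Ψ ∈ Potential ]
    Feasible A × TracksThrough A σ ×
    NonNegative Ψ × InitiallyZero Ψ × PropertyS A Ψ × PropertyT Ψ
lemma55 {I = I} X Y = tracker , freePairing , potential
  , tracker-feasible , tracks
  , (λ R → matchingCost-nonNegative (pairing R)) , (λ _ → matchingCost-id)
  , propertyS , propertyT
  where
  open MatchingProperties I
  open TrackingProperties X Y
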